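{- Let $T$ be a finite nonabelian simple group, and let $\{a,b\}$ be a generating set for $T$ such that no automorphism of $T$ interchanges $a$ and $b$. Let $N=T\times T$, $S_0=\{(a,b),(b,a)\}$, $S=S_0\cup S_0^{ -1}$, and $\Gamma=\mathrm{Cay}(N,S)$. Let $\tau\in\mathrm{Aut}(N)$ be the map $\tau:(x,y)\mapsto(y,x)$, and let $G=N\rtimes\langle\tau\rangle$, where $N$ acts on the vertex set $N$ by right multiplication and $\tau$ acts naturally as an automorphism of $N$. Then $(\Gamma,G)$ lies in $\mathcal{OG}(4)$ and is basic of quasiprimitive type.
   Context: All graphs are finite, simple and undirected. For a group $N$ and an inverse-closed subset $S\subseteq N\setminus\{1_N\}$, the Cayley graph $\mathrm{Cay}(N,S)$ has vertex set $N$ and edges the pairs $\{x,y\}$ with $xy^{ -1}\in S$. When $S=S_0\cup S_0^{ -1}$ with $S_0\cap S_0^{ -1}=\emptyset$, each edge $\{x,y\}$ is oriented $x\to y$ if and only if $yx^{ -1}\in S_0$. $\mathcal{OG}(4)$ is the set of pairs $(\Gamma,G)$ where $\Gamma$ is a connected graph of valency $4$ with vertex set $X$, and $G\leq\mathrm{Aut}(\Gamma)$ is transitive on $X$ and on edges, and $\Gamma$ is $G$-oriented: there is a $G$-orbit $\Delta\subset X\times X$, disjoint from $\Delta^*=\{(y,x)\mid (x,y)\in\Delta\}$, such that the edges of $\Gamma$ are exactly the pairs $\{x,y\}$ with $(x,y)\in\Delta$ or $(y,x)\in\Delta$. A pair $(\Gamma,G)\in\mathcal{OG}(4)$ is basic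 of quasiprimitive type if $G$ is quasiprimitive on $X$, that is, every nontrivial normal subgroup of $G$ is transitive on $X$. -}

module Defs where

open import Level using (Level; _⊔_; suc)
open import Algebra.Bundles using (Group)
open import Algebra.Definitions using (Commutative)
import Algebra.Construct.DirectProduct as DirectProduct
open import Algebra.Morphism.Structures using (module GroupMorphisms)
import Algebra.Morphism.Construct.Composition as Compose
import Algebra.Morphism.Construct.Identity as Identity
import Algebra.Properties.Group as GroupProperties
open import Data.Fin.Base using (Fin)
open import Data.Fin.Properties using (*↔×)
open import Data.Nat.Base using (ℕ)
open import Data.Product.Base using (Σ; ∃; ∃₂; _×_; _,_; proj₁; proj₂; swap)
open import Data.Product.Function.NonDependent.Setoid using (_×-inverse_)
open import Data.Product.Relation.Binary.Pointwise.NonDependent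
  using (_×ₛ_; Pointwise-≡↔≡)
open import Data.Sum.Base using (_⊎_)
open import Function.Base using (id; _∘_)
open import Function.Bundles using (Inverse; _⇔_)
import Function.Construct.Composition as FComp
import Function.Construct.Symmetry as FSym
open import Relation.Binary.Bundles using (Setoid)
open import Relation.Binary.Construct.Closure.ReflexiveTransitive using (Star)
import Relation.Binary.Construct.On as On
open import Relation.Binary.Core using (Rel)
open import Relation.Binary.Definitions
  using (Symmetric; _Respects_; _Respects₂_)
open import Relation.Binary.PropositionalEquality using (setoid)
open import Relation.Nullary.Negation using (¬_)
open import Relation.Unary using (Pred; _∈_; _∉_; _∪_)

private
  variable
    c ℓ p e v g ℓg : Level

------------------------------------------------------------------------
-- Finiteness

HasSize : Setoid c ℓ → ℕ → Set (c ⊔ ℓ)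
HasSize S n = Inverse S (setoid (Fin n))

Finite : Setoid c ℓ → Set (c ⊔ ℓ)
Finite S = ∃ (HasSize S)

finite-× : (A : Setoid c ℓ) (B : Setoid v e) →
           Finite A → Finite B → Finite (A ×ₛ B)
finite-× A B (m , f) (n , h) =
  _ , FComp.inverse (FComp.inverse (f ×-inverse h) Pointwise-≡↔≡)
                    (FSym.inverse (*↔× {m} {n}))

------------------------------------------------------------------------
-- Groups

module _ (G : Group c ℓ) where
  open Group G

  IsAbelian : Set (c ⊔ ℓ)
  IsAbelian = Commutative _≈_ _∙_

  record IsSubgroup (H : Pred Carrier p) : Set (c ⊔ ℓ ⊔ p) where
    field
      resp      : H Respects _≈_
      ε-closed  : ε ∈ H
      ∙-closed  : ∀ {x y} → x ∈ H → y ∈ H → x ∙ y ∈ H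
      ⁻¹-closed : ∀ {x} → x ∈ H → x ⁻¹ ∈ H

  record IsNormalSubgroup (H : Pred Carrier p) : Set (c ⊔ ℓ ⊔ p) where
    field
      isSubgroup  : IsSubgroup H
      conj-closed : ∀ {x} y → x ∈ H → y ⁻¹ ∙ x ∙ y ∈ H

  Nontrivial : Pred Carrier p → Set (c ⊔ ℓ ⊔ p)
  Nontrivial H = ∃ λ x → x ∈ H × ¬ (x ≈ ε)

  -- "Trivial or everything" is stated as "everything if nontrivial": as H
  -- ranges over arbitrary, possibly undecidable, predicates, the disjunctive
  -- form would make excluded middle part of the hypothesis.
  record IsSimple : Set (suc (c ⊔ ℓ)) where
    field
      nontrivial : ¬ (∀ x → x ≈ ε)
      normal     : ∀ {H : Pred Carrier (c ⊔ ℓ)} → IsNormalSubgroup H →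
                   Nontrivial H → ∀ x → x ∈ H

  data ⟨_⟩ (P : Pred Carrier p) : Pred Carrier (c ⊔ ℓ ⊔ p) where
    gen  : ∀ {x} → x ∈ P → ⟨ P ⟩ x
    cast : ∀ {x y} → x ≈ y → ⟨ P ⟩ x → ⟨ P ⟩ y
    unit : ⟨ P ⟩ ε
    mul  : ∀ {x y} → ⟨ P ⟩ x → ⟨ P ⟩ y → ⟨ P ⟩ (x ∙ y)
    inv  : ∀ {x} → ⟨ P ⟩ x → ⟨ P ⟩ (x ⁻¹)

  ⟨⟩-isSubgroup : (P : Pred Carrier p) → IsSubgroup ⟨ P ⟩
  ⟨⟩-isSubgroup P = record
    { resp = cast ; ε-closed = unit ; ∙-closed = mul ; ⁻¹-closed = inv }

  Generates : Pred Carrier p → Set (c ⊔ ℓ ⊔ p)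
  Generates P = ∀ x → x ∈ ⟨ P ⟩

  doubleton : Carrier → Carrier → Pred Carrier ℓ
  doubleton x y z = z ≈ x ⊎ z ≈ y

  subgroup : {H : Pred Carrier p} → IsSubgroup H → Group (c ⊔ p) ℓ
  subgroup {H = H} isSub = record
    { Carrier = Σ Carrier H
    ; _≈_     = λ x y → proj₁ x ≈ proj₁ y
    ; _∙_     = λ x y → proj₁ x ∙ proj₁ y , ∙-closed (proj₂ x) (proj₂ y)
    ; ε       = ε , ε-closed
    ; _⁻¹     = λ x → proj₁ x ⁻¹ , ⁻¹-closed (proj₂ x)
    ; isGroup = record
      { isMonoid = record
        { isSemigroup = record
          { isMagma = record
            { isEquivalence = record { refl = refl ; sym = sym ; trans = trans }
            ; ∙-cong        = ∙-cong
            }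
          ; assoc = λ x y z → assoc (proj₁ x) (proj₁ y) (proj₁ z)
          }
        ; identity = (λ x → identityˡ (proj₁ x)) , (λ x → identityʳ (proj₁ x))
        }
      ; inverse = (λ x → inverseˡ (proj₁ x)) , (λ x → inverseʳ (proj₁ x))
      ; ⁻¹-cong = ⁻¹-cong
      }
    }
    where open IsSubgroup isSub

------------------------------------------------------------------------
-- The automorphism group

module _ (G : Group c ℓ) where
  open Group G
  open GroupMorphisms rawGroup rawGroup

  record Automorphism : Set (c ⊔ ℓ) where
    field
      ⟦_⟧                : Carrier → Carrier
      isGroupIsomorphism : IsGroupIsomorphism ⟦_⟧
    open IsGroupIsomorphism isGroupIsomorphism public

  open Automorphism

  private
    inverseAut : Automorphism → Automorphism
    inverseAut α = record
      { ⟦_⟧ = α⁻¹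
      ; isGroupIsomorphism = record
        { isGroupMonomorphism = record
          { isGroupHomomorphism = record
            { isMonoidHomomorphism = record
              { isMagmaHomomorphism = record
                { isRelHomomorphism = record
                  { cong = λ {x} {y} x≈y → injective α
                      (trans (αα⁻¹ x) (trans x≈y (sym (αα⁻¹ y)))) }
                ; homo = λ x y → injective α (trans (αα⁻¹ (x ∙ y)) (sym
                    (trans (∙-homo α (α⁻¹ x) (α⁻¹ y)) (∙-cong (αα⁻¹ x) (αα⁻¹ y)))))
                }
              ; ε-homo = injective α (trans (αα⁻¹ ε) (sym (ε-homo α)))
              }
            ; ⁻¹-homo = λ x → injective α (trans (αα⁻¹ (x ⁻¹)) (sym
                (trans (⁻¹-homo α (α⁻¹ x)) (⁻¹-cong (αα⁻¹ x)))))
            }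
          ; injective = λ {x} {y} eq →
              trans (sym (αα⁻¹ x)) (trans (⟦⟧-cong α eq) (αα⁻¹ y))
          }
        ; surjective = λ x → ⟦ α ⟧ x , λ {z} z≈αx →
            injective α (trans (αα⁻¹ z) z≈αx)
        }
      }
      where
      α⁻¹ : Carrier → Carrier
      α⁻¹ x = proj₁ (surjective α x)

      αα⁻¹ : ∀ x → ⟦ α ⟧ (α⁻¹ x) ≈ x
      αα⁻¹ x = proj₂ (surjective α x) refl

  -- Automorphisms act on the right: α ∙ β means "first α, then β".
  Aut : Group (c ⊔ ℓ) (c ⊔ ℓ)
  Aut = record
    { Carrier = Automorphism
    ; _≈_     = λ α β → ∀ x → ⟦ α ⟧ x ≈ ⟦ β ⟧ x
    ; _∙_     = λ α β → record
      { ⟦_⟧                = ⟦ β ⟧ ∘ ⟦ α ⟧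
      ; isGroupIsomorphism = Compose.isGroupIsomorphism trans
          (isGroupIsomorphism α) (isGroupIsomorphism β)
      }
    ; ε       = record
      { ⟦_⟧ = id ; isGroupIsomorphism = Identity.isGroupIsomorphism rawGroup refl }
    ; _⁻¹     = inverseAut
    ; isGroup = record
      { isMonoid = record
        { isSemigroup = record
          { isMagma = record
            { isEquivalence = record
              { refl  = λ _ → refl
              ; sym   = λ p x → sym (p x)
              ; trans = λ p q x → trans (p x) (q x)
              }
            ; ∙-cong = λ {α} {β} {γ} {δ} p q x →
                trans (⟦⟧-cong γ (p x)) (q (⟦ β ⟧ x))
            }
          ; assoc = λ _ _ _ _ → refl
          }
        ; identity = (λ _ _ → refl) , (λ _ _ → refl)
        }
      ; inverse = (λ α x → proj₂ (surjective α x) refl)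
                , (λ α x → injective α (proj₂ (surjective α (⟦ α ⟧ x)) refl))
      ; ⁻¹-cong = λ {α} {β} p x → injective β (trans
          (sym (p (proj₁ (surjective α x))))
          (trans (proj₂ (surjective α x) refl)
                 (sym (proj₂ (surjective β x) refl))))
      }
    }

------------------------------------------------------------------------
-- Semidirect product N ⋊ A with a group A of automorphisms of N

-- The pair (n , α) stands for the product αn, "first α, then n", so that
-- (αn)(βm) = αβ · β(n) · m.

module _ (N : Group c ℓ) {A : Pred (Automorphism N) p}
         (isSub : IsSubgroup (Aut N) A) where
  open Group N
  open Automorphism
  private
    module A = Group (subgroup (Aut N) isSub)

    act : A.Carrier → Carrier → Carrier
    act α = ⟦ proj₁ α ⟧

  semidirect : Group (c ⊔ ℓ ⊔ p) (c ⊔ ℓ)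
  semidirect = record
    { Carrier = Carrier × A.Carrier
    ; _≈_     = λ (n , α) (m , β) → n ≈ m × α A.≈ β
    ; _∙_     = λ (n , α) (m , β) → act β n ∙ m , α A.∙ β
    ; ε       = ε , A.ε
    ; _⁻¹     = λ (n , α) → act (α A.⁻¹) (n ⁻¹) , α A.⁻¹
    ; isGroup = record
      { isMonoid = record
        { isSemigroup = record
          { isMagma = record
            { isEquivalence = record
              { refl  = λ {(n , α)} → refl , A.refl {α}
              ; sym   = λ {(n , α)} {(m , β)} (p , q) → sym p , A.sym {α} {β} q
              ; trans = λ {(n , α)} {(m , β)} {(k , γ)} (p , q) (p′ , q′) →
                  trans p p′ , A.trans {α} {β} {γ} q q′
              }
            ; ∙-cong = λ {(n , α)} {(m , β)} {(k , γ)} {(l , δ)} (p , q) (p′ , q′) →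
                ∙-cong (trans (⟦⟧-cong (proj₁ γ) p) (q′ m)) p′
                , A.∙-cong {α} {β} {γ} {δ} q q′
            }
          ; assoc = λ (n , α) (m , β) (k , γ) →
              trans (∙-congʳ (∙-homo (proj₁ γ) (act β n) m)) (assoc _ _ _)
              , A.assoc α β γ
          }
        ; identity =
            (λ (n , α) → trans (∙-congʳ (ε-homo (proj₁ α))) (identityˡ n)
                       , A.identityˡ α)
          , (λ (n , α) → identityʳ n , A.identityʳ α)
        }
      ; inverse =
          (λ (n , α) → trans (∙-congʳ (A.inverseˡ α (n ⁻¹))) (inverseˡ n)
                     , A.inverseˡ α)
        , (λ (n , α) → trans (sym (∙-homo (proj₁ (α A.⁻¹)) n (n ⁻¹)))
              (trans (⟦⟧-cong (proj₁ (α A.⁻¹)) (inverseʳ n))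
                     (ε-homo (proj₁ (α A.⁻¹))))
            , A.inverseʳ α)
      ; ⁻¹-cong = λ {(n , α)} {(m , β)} (p , q) →
          trans (⟦⟧-cong (proj₁ (α A.⁻¹)) (⁻¹-cong p))
                (A.⁻¹-cong {α} {β} q (m ⁻¹))
        , A.⁻¹-cong {α} {β} q
      }
    }

  -- N acts on itself by right multiplication, A by its natural action.
  semidirectAction : Carrier → Group.Carrier semidirect → Carrier
  semidirectAction x (n , α) = act α x ∙ n

------------------------------------------------------------------------
-- Graphs (finite, simple, undirected)

record Graph v ℓ e : Set (suc (v ⊔ ℓ ⊔ e)) where
  field
    vertices : Setoid v ℓ
  open Setoid vertices public using () renaming (Carrier to Vertex; _≈_ to _≈ᵥ_)
  field
    finite   : Finite vertices
    Adj      : Rel Vertex e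
    Adj-resp : Adj Respects₂ _≈ᵥ_
    Adj-sym  : Symmetric Adj
    loopless : ∀ {x} → ¬ Adj x x

  neighbours : Vertex → Setoid (v ⊔ e) ℓ
  neighbours x = On.setoid {B = ∃ (Adj x)} vertices proj₁

  HasValency : ℕ → Set (v ⊔ ℓ ⊔ e)
  HasValency k = ∀ x → HasSize (neighbours x) k

  -- A step x ≈ y is a walk of length 0.
  Connected : Set (v ⊔ ℓ ⊔ e)
  Connected = ∀ x y → Star (λ u w → u ≈ᵥ w ⊎ Adj u w) x y

module _ (N : Group c ℓ) where
  open Group N renaming (setoid to setoidN)

  record IsConnectionSet (S : Pred Carrier p) : Set (c ⊔ ℓ ⊔ p) where
    field
      resp      : S Respects _≈_
      ε∉S       : ε ∉ S
      ⁻¹-closed : ∀ {x} → x ∈ S → x ⁻¹ ∈ S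

  _⁻¹ˢ : Pred Carrier p → Pred Carrier p
  (S ⁻¹ˢ) x = x ⁻¹ ∈ S

  Cay : Finite setoidN → {S : Pred Carrier p} → IsConnectionSet S → Graph c ℓ p
  Cay fin {S} isConn = record
    { vertices = setoidN
    ; finite   = fin
    ; Adj      = λ x y → x ∙ y ⁻¹ ∈ S
    ; Adj-resp = (λ y≈z → resp (∙-congˡ (⁻¹-cong y≈z)))
               , (λ y≈z → resp (∙-congʳ y≈z))
    ; Adj-sym  = λ {x} {y} xy∈S → resp
        (trans (⁻¹-anti-homo-∙ x (y ⁻¹)) (∙-congʳ (⁻¹-involutive y)))
        (⁻¹-closed xy∈S)
    ; loopless = λ {x} xx∈S → ε∉S (resp (inverseʳ x) xx∈S)
    }
    where
    open IsConnectionSet isConn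
    open GroupProperties N using (⁻¹-anti-homo-∙; ⁻¹-involutive)

------------------------------------------------------------------------
-- Groups of automorphisms of a graph, OG(4), quasiprimitivity

-- A subgroup G of Aut Γ is presented as a group together with a faithful
-- right action _·_ on the vertices preserving adjacency.

module _ (Γ : Graph v ℓ e) (G : Group g ℓg) where
  open Graph Γ
  private module G = Group G

  module _ (_·_ : Vertex → G.Carrier → Vertex) where

    record IsAutomorphismGroup : Set (v ⊔ ℓ ⊔ e ⊔ g ⊔ ℓg) where
      field
        ·-cong     : ∀ {x y h k} → x ≈ᵥ y → h G.≈ k → (x · h) ≈ᵥ (y · k)
        ·-identity : ∀ x → (x · G.ε) ≈ᵥ x
        ·-compat   : ∀ x h k → (x · (h G.∙ k)) ≈ᵥ ((x · h) · k)
        faithful   : ∀ h → (∀ x → (x · h) ≈ᵥ x) → h G.≈ G.ε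
        preserves  : ∀ h x y → Adj x y ⇔ Adj (x · h) (y · h)

    IsTransitive : Pred G.Carrier p → Set (v ⊔ ℓ ⊔ g ⊔ p)
    IsTransitive H = ∀ x y → ∃ λ h → h ∈ H × (x · h) ≈ᵥ y

    IsVertexTransitive : Set (v ⊔ ℓ ⊔ g)
    IsVertexTransitive = ∀ x y → ∃ λ h → (x · h) ≈ᵥ y

    IsEdgeTransitive : Set (v ⊔ ℓ ⊔ e ⊔ g)
    IsEdgeTransitive = ∀ {x y x′ y′} → Adj x y → Adj x′ y′ → ∃ λ h →
      ((x · h) ≈ᵥ x′ × (y · h) ≈ᵥ y′) ⊎ ((x · h) ≈ᵥ y′ × (y · h) ≈ᵥ x′)

    PairOrbit : Vertex → Vertex → Rel Vertex (ℓ ⊔ g)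
    PairOrbit x₀ y₀ x y = ∃ λ h → (x₀ · h) ≈ᵥ x × (y₀ · h) ≈ᵥ y

    IsOriented : Set (v ⊔ ℓ ⊔ e ⊔ g)
    IsOriented = ∃₂ λ x₀ y₀ → let Δ = PairOrbit x₀ y₀ in
      (∀ x y → Δ x y → ¬ Δ y x) ×
      (∀ x y → Adj x y ⇔ (Δ x y ⊎ Δ y x))

    record InOG4 : Set (v ⊔ ℓ ⊔ e ⊔ g ⊔ ℓg) where
      field
        connected           : Connected
        valency4            : HasValency 4
        isAutomorphismGroup : IsAutomorphismGroup
        vertexTransitive    : IsVertexTransitive
        edgeTransitive      : IsEdgeTransitive
        oriented            : IsOriented

    -- p is the universe level of the normal subgroups considered.
    IsQuasiprimitive : ∀ p → Set (v ⊔ ℓ ⊔ g ⊔ ℓg ⊔ suc p)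
    IsQuasiprimitive p = {H : Pred G.Carrier p} →
      IsNormalSubgroup G H → Nontrivial G H → IsTransitive H

    record IsBasicQuasiprimitive p : Set (v ⊔ ℓ ⊔ e ⊔ g ⊔ ℓg ⊔ suc p) where
      field
        inOG4          : InOG4
        quasiprimitive : IsQuasiprimitive p

------------------------------------------------------------------------
-- The construction

module Construction (T : Group c ℓ) where
  private module T = Group T

  N : Group c ℓ
  N = DirectProduct.group T T

  private module N = Group N

  finiteN : Finite T.setoid → Finite N.setoid
  finiteN fin = finite-× T.setoid T.setoid fin fin

  S₀ : T.Carrier → T.Carrier → Pred N.Carrier ℓ
  S₀ a b = doubleton N (a , b) (b , a)

  S : T.Carrier → T.Carrier → Pred N.Carrier ℓ
  S a b = S₀ a b ∪ (_⁻¹ˢ N (S₀ a b))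

  τ : Automorphism N
  τ = record
    { ⟦_⟧ = swap
    ; isGroupIsomorphism = record
      { isGroupMonomorphism = record
        { isGroupHomomorphism = record
          { isMonoidHomomorphism = record
            { isMagmaHomomorphism = record
              { isRelHomomorphism = record { cong = swap }
              ; homo              = λ _ _ → N.refl
              }
            ; ε-homo = N.refl
            }
          ; ⁻¹-homo = λ _ → N.refl
          }
        ; injective = swap
        }
      ; surjective = λ x → swap x , swap
      }
    }

  ⟨τ⟩ : Pred (Automorphism N) (c ⊔ ℓ)
  ⟨τ⟩ = ⟨_⟩ (Aut N) (Group._≈_ (Aut N) τ)

  ⟨τ⟩-isSubgroup : IsSubgroup (Aut N) ⟨τ⟩
  ⟨τ⟩-isSubgroup = ⟨⟩-isSubgroup (Aut N) (Group._≈_ (Aut N) τ)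

  G : Group (c ⊔ ℓ) (c ⊔ ℓ)
  G = semidirect N ⟨τ⟩-isSubgroup

  action : N.Carrier → Group.Carrier G → N.Carrier
  action = semidirectAction N ⟨τ⟩-isSubgroup

-- Two ideas carry the proof.  By Goursat, a proper subgroup of T × T that
-- contains (a , b) and (b , a) meets T × 1 trivially, hence is the graph of an
-- automorphism of T interchanging a and b; so these two elements generate
-- T × T, and Γ is connected.  A nontrivial normal subgroup of G meets N in an
-- element with first component not 1; its commutator with a suitable (t , 1) is
-- a nontrivial element of T × 1, so the normal subgroup contains T × 1, its
-- conjugate 1 × T, and therefore the regular subgroup N.
module Submission where

open import Defs
open import Algebra.Bundles using (Group)
open import Data.Product.Base using (Σ-syntax; ∃-syntax; _×_)
open import Relation.Nullary.Negation using (¬_)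

open import Level using (Level; _⊔_)
import Algebra.Properties.Group as GroupProperties
open import Data.Empty using (⊥; ⊥-elim)
open import Data.Fin.Base using (Fin)
open import Data.Fin.Patterns using (0F; 1F; 2F; 3F)
open import Data.Fin.Properties using (_≟_; any?)
open import Data.List.Base using (List; []; _∷_; tabulate)
import Data.List.Membership.Setoid as Membership
open import Data.List.Relation.Unary.Any using (here; there)
open import Data.List.Relation.Unary.Any.Properties using (tabulate⁺)
open import Data.Product.Base using (∃; _,_; proj₁; proj₂; swap)
open import Data.Sum.Base as Sum using (_⊎_; inj₁; inj₂; [_,_]′)
open import Function.Base using (_∘_)
open import Function.Bundles using (Inverse; mk⇔; module Equivalence)
import Function.Properties.Inverse as Inv
open import Relation.Binary.Bundles using (Setoid)
open import Relation.Binary.Construct.Closure.ReflexiveTransitive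
  using (Star; _◅◅_; fold; reverse)
  renaming (return to step)
open import Relation.Binary.Core using (Rel)
open import Relation.Binary.Definitions using (Decidable; Reflexive; _Respects₂_)
open import Relation.Binary.PropositionalEquality as ≡ using (_≡_)
import Relation.Binary.Reasoning.Setoid as SetoidReasoning
open import Relation.Nullary.Decidable
  using (Dec; yes; no; map′; ¬?; via-injection; _⊎-dec_; _×-dec_; decidable-stable)
open import Relation.Unary using (Pred; _∈_; _⊆_; _∪_)

private
  variable
    c ℓ p q e v g ℓg : Level

-- Decidability over finite setoids

module _ (A : Setoid c ℓ) where
  open Setoid A
  open Membership A using () renaming (_∈_ to _∈ₗ_)

  finite⇒dec-≈ : Finite A → Decidable _≈_
  finite⇒dec-≈ (_ , i) = via-injection (Inv.Inverse⇒Injection i) _≟_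

  -- Warshall's algorithm: chains of E-steps whose intermediate points are listed.
  Through : Rel Carrier e → List Carrier → Rel Carrier e
  Through E []       x y = E x y
  Through E (v ∷ vs) x y = Through E vs x y ⊎ (Through E vs x v × Through E vs v y)

  module _ {E : Rel Carrier e} where

    through? : Decidable E → ∀ vs → Decidable (Through E vs)
    through? E? []       x y = E? x y
    through? E? (v ∷ vs) x y =
      through? E? vs x y ⊎-dec (through? E? vs x v ×-dec through? E? vs v y)

    edge⇒through : ∀ vs {x y} → E x y → Through E vs x y
    edge⇒through []       xy = xy
    edge⇒through (v ∷ vs) xy = inj₁ (edge⇒through vs xy)

    through⇒star : ∀ vs {x y} → Through E vs x y → Star E x y
    through⇒star []       xy              = step xy
    through⇒star (v ∷ vs) (inj₁ xy)       = through⇒star vs xy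
    through⇒star (v ∷ vs) (inj₂ (xv , vy)) = through⇒star vs xv ◅◅ through⇒star vs vy

    module _ (resp : E Respects₂ _≈_) where

      through-resp : ∀ vs → Through E vs Respects₂ _≈_
      through-resp []       = resp
      through-resp (v ∷ vs) =
          (λ y≈z → Sum.map (proj₁ r y≈z) λ (xv , vy) → xv , proj₁ r y≈z vy)
        , (λ y≈z → Sum.map (proj₂ r y≈z) λ (yv , vx) → proj₂ r y≈z yv , vx)
        where r = through-resp vs

      -- If `y` is the head pivot, each leg can be cut at its first arrival at, or last departure
      -- from, that pivot, so neither leg needs it as an inner point. Otherwise, when both legs pass
      -- through the head `v`, the detour from `v` over `y` back to `v` is dropped.
      through-trans : ∀ vs {x y z} → y ∈ₗ vs →
                      Through E vs x y → Through E vs y z → Through E vs x z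
      through-trans (v ∷ vs) (here y≈v) xy yz =
        inj₂ ( [ proj₁ r y≈v , proj₁ ]′ xy , [ proj₂ r y≈v , proj₂ ]′ yz )
        where r = through-resp vs
      through-trans (v ∷ vs) (there y∈) (inj₁ xy) (inj₁ yz) =
        inj₁ (through-trans vs y∈ xy yz)
      through-trans (v ∷ vs) (there y∈) (inj₁ xy) (inj₂ (yv , vz)) =
        inj₂ (through-trans vs y∈ xy yv , vz)
      through-trans (v ∷ vs) (there y∈) (inj₂ (xv , vy)) (inj₁ yz) =
        inj₂ (xv , through-trans vs y∈ vy yz)
      through-trans (v ∷ vs) (there y∈) (inj₂ (xv , _)) (inj₂ (_ , vz)) =
        inj₂ (xv , vz)

    -- With every point listed as a pivot, `through-trans` can prepend an edge to any chain, so
    -- folding a walk turns it into a chain, and chains are decidable. Reflexivity of `E` covers the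
    -- empty walk.
    star? : Finite A → E Respects₂ _≈_ → Reflexive E → Decidable E → Decidable (Star E)
    star? (n , i) resp E-refl E? x y =
      map′ (through⇒star all)
           (fold (Through E all)
                 (λ {_} {w} xw wy → through-trans resp all (listed w) (edge⇒through all xw) wy)
                 (edge⇒through all E-refl))
           (through? E? all x y)
      where
      open Inverse i
      all = tabulate from
      listed : ∀ w → w ∈ₗ all
      listed w = tabulate⁺ (to w) (sym (inverseʳ ≡.refl))

  any-finite? : Finite A → {P : Pred Carrier p} → (∀ {x y} → x ≈ y → P x → P y) →
                (∀ x → Dec (P x)) → Dec (∃ P)
  any-finite? (n , i) resp P? =
    map′ (λ (k , pk) → from k , pk) (λ (x , px) → to x , resp (sym (inverseʳ ≡.refl)) px)
         (any? (P? ∘ from))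
    where open Inverse i

-- Subgroups

module _ (G : Group c ℓ) where
  open Group G
  open GroupProperties G
  open SetoidReasoning setoid

  -- Serves as the induction principle for generated subgroups; `H` may live at any level, so it can
  -- also be a property such as the existence of a walk.
  ⟨⟩-least : {P : Pred Carrier p} {H : Pred Carrier q} → IsSubgroup G H →
             P ⊆ H → ⟨ G ⟩ P ⊆ H
  ⟨⟩-least isSub P⊆H = go
    where
    open IsSubgroup isSub
    go : ⟨ G ⟩ _ ⊆ _
    go (gen x∈P)  = P⊆H x∈P
    go (cast e x) = resp e (go x)
    go unit       = ε-closed
    go (mul x y)  = ∙-closed (go x) (go y)
    go (inv x)    = ⁻¹-closed (go x)

  Centraliser : Carrier → Pred Carrier ℓ
  Centraliser x y = x ∙ y ≈ y ∙ x

  Centraliser-isSubgroup : ∀ x → IsSubgroup G (Centraliser x)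
  Centraliser-isSubgroup x = record
    { resp      = λ y≈z xy → trans (∙-congˡ (sym y≈z)) (trans xy (∙-congʳ y≈z))
    ; ε-closed  = trans (identityʳ x) (sym (identityˡ x))
    ; ∙-closed  = λ {y} {z} xy xz → begin
        x ∙ (y ∙ z) ≈⟨ assoc x y z ⟨
        x ∙ y ∙ z   ≈⟨ ∙-congʳ xy ⟩
        y ∙ x ∙ z   ≈⟨ assoc y x z ⟩
        y ∙ (x ∙ z) ≈⟨ ∙-congˡ xz ⟩
        y ∙ (z ∙ x) ≈⟨ assoc y z x ⟨
        y ∙ z ∙ x   ∎
    ; ⁻¹-closed = λ {y} xy → ∙-cancelˡ y _ _ (begin
        y ∙ (x ∙ y ⁻¹)   ≈⟨ assoc y x (y ⁻¹) ⟨
        y ∙ x ∙ y ⁻¹     ≈⟨ ∙-congʳ xy ⟨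
        x ∙ y ∙ y ⁻¹     ≈⟨ assoc x y (y ⁻¹) ⟩
        x ∙ (y ∙ y ⁻¹)   ≈⟨ ∙-congˡ (inverseʳ y) ⟩
        x ∙ ε            ≈⟨ identityʳ x ⟩
        x                ≈⟨ identityˡ x ⟨
        ε ∙ x            ≈⟨ ∙-congʳ (inverseʳ y) ⟨
        y ∙ y ⁻¹ ∙ x     ≈⟨ assoc y (y ⁻¹) x ⟩
        y ∙ (y ⁻¹ ∙ x)   ∎)
    }

  -- Centralisers are used twice: first each generator is shown to commute with the arbitrary `x`,
  -- then the centraliser of `x`, containing all generators, is everything.
  commutingGenerators⇒abelian : {P : Pred Carrier p} → Generates G P →
    (∀ {x y} → x ∈ P → y ∈ P → x ∙ y ≈ y ∙ x) → IsAbelian G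
  commutingGenerators⇒abelian {P = P} gens comm x y =
    ⟨⟩-least (Centraliser-isSubgroup x)
      (λ {s} s∈P → sym (⟨⟩-least (Centraliser-isSubgroup s) (comm s∈P) (gens x)))
      (gens y)

  -- Conjugation and normalisers

  conj : Carrier → Carrier → Carrier
  conj y x = y ⁻¹ ∙ x ∙ y

  conj-cong : ∀ {y z x w} → y ≈ z → x ≈ w → conj y x ≈ conj z w
  conj-cong y≈z x≈w = ∙-cong (∙-cong (⁻¹-cong y≈z) x≈w) y≈z

  conj-homo : ∀ y x z → conj y (x ∙ z) ≈ conj y x ∙ conj y z
  conj-homo y x z = begin
    y ⁻¹ ∙ (x ∙ z) ∙ y                ≈⟨ ∙-congʳ (assoc (y ⁻¹) x z) ⟨
    y ⁻¹ ∙ x ∙ z ∙ y                  ≈⟨ assoc (y ⁻¹ ∙ x) z y ⟩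
    y ⁻¹ ∙ x ∙ (z ∙ y)                ≈⟨ ∙-congˡ (\\-leftDividesˡ y (z ∙ y)) ⟨
    y ⁻¹ ∙ x ∙ (y ∙ (y ⁻¹ ∙ (z ∙ y))) ≈⟨ assoc (y ⁻¹ ∙ x) y _ ⟨
    conj y x ∙ (y ⁻¹ ∙ (z ∙ y))       ≈⟨ ∙-congˡ (assoc (y ⁻¹) z y) ⟨
    conj y x ∙ conj y z               ∎

  conj-ε : ∀ y → conj y ε ≈ ε
  conj-ε y = trans (∙-congʳ (identityʳ (y ⁻¹))) (inverseˡ y)

  conj-⁻¹ : ∀ y x → conj y (x ⁻¹) ≈ conj y x ⁻¹
  conj-⁻¹ y x = inverseˡ-unique _ _ (begin
    conj y (x ⁻¹) ∙ conj y x ≈⟨ conj-homo y (x ⁻¹) x ⟨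
    conj y (x ⁻¹ ∙ x)        ≈⟨ conj-cong refl (inverseˡ x) ⟩
    conj y ε                 ≈⟨ conj-ε y ⟩
    ε                        ∎)

  conj-identity : ∀ x → conj ε x ≈ x
  conj-identity x = trans (identityʳ _) (trans (∙-congʳ ε⁻¹≈ε) (identityˡ x))

  conj-compat : ∀ y z x → conj (y ∙ z) x ≈ conj z (conj y x)
  conj-compat y z x = begin
    (y ∙ z) ⁻¹ ∙ x ∙ (y ∙ z)       ≈⟨ ∙-congʳ (∙-congʳ (⁻¹-anti-homo-∙ y z)) ⟩
    z ⁻¹ ∙ y ⁻¹ ∙ x ∙ (y ∙ z)      ≈⟨ assoc _ y z ⟨
    z ⁻¹ ∙ y ⁻¹ ∙ x ∙ y ∙ z        ≈⟨ ∙-congʳ (∙-congʳ (assoc _ _ x)) ⟩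
    z ⁻¹ ∙ (y ⁻¹ ∙ x) ∙ y ∙ z      ≈⟨ ∙-congʳ (assoc _ _ y) ⟩
    z ⁻¹ ∙ (y ⁻¹ ∙ x ∙ y) ∙ z      ∎

  -- Allows a claim about conjugates of a generated subgroup to be checked on its generators alone.
  conjPreimage-isSubgroup : ∀ y {H : Pred Carrier p} → IsSubgroup G H →
                            IsSubgroup G (λ x → conj y x ∈ H)
  conjPreimage-isSubgroup y isSub = record
    { resp      = λ x≈z → resp (conj-cong refl x≈z)
    ; ε-closed  = resp (sym (conj-ε y)) ε-closed
    ; ∙-closed  = λ {x} {z} hx hz → resp (sym (conj-homo y x z)) (∙-closed hx hz)
    ; ⁻¹-closed = λ {x} hx → resp (sym (conj-⁻¹ y x)) (⁻¹-closed hx)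
    }
    where open IsSubgroup isSub

  Normalises : Pred Carrier p → Pred Carrier (c ⊔ p)
  Normalises H y = ∀ {x} → x ∈ H → conj y x ∈ H

  -- In an infinite group conjugation by `y` can map `H` properly into itself; demanding the
  -- inclusion for `y ⁻¹` as well gives closure under inverses.
  Normaliser : Pred Carrier p → Pred Carrier (c ⊔ p)
  Normaliser H y = Normalises H y × Normalises H (y ⁻¹)

  Normaliser-isSubgroup : {H : Pred Carrier p} → IsSubgroup G H →
                          IsSubgroup G (Normaliser H)
  Normaliser-isSubgroup isSub = record
    { resp      = λ y≈z (n , n′) → (λ hx → resp (conj-cong y≈z refl) (n hx))
                                 , (λ hx → resp (conj-cong (⁻¹-cong y≈z) refl) (n′ hx))
    ; ε-closed  = (λ hx → resp (sym (conj-identity _)) hx)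
                , (λ hx → resp (sym (trans (conj-cong ε⁻¹≈ε refl) (conj-identity _))) hx)
    ; ∙-closed  = λ {y} {z} (n , n′) (m , m′) →
          (λ hx → resp (sym (conj-compat y z _)) (m (n hx)))
        , (λ hx → resp (sym (trans (conj-cong (⁻¹-anti-homo-∙ y z) refl)
                                   (conj-compat (z ⁻¹) (y ⁻¹) _))) (n′ (m′ hx)))
    ; ⁻¹-closed = λ {y} (n , n′) →
          n′ , (λ hx → resp (conj-cong (sym (⁻¹-involutive y)) refl) (n hx))
    }
    where open IsSubgroup isSub

  -- Normal closures, simplicity and the centre

  Conjugates : Carrier → Pred Carrier (c ⊔ ℓ)
  Conjugates t z = ∃[ y ] z ≈ conj y t

  normalClosure-isNormal : ∀ t → IsNormalSubgroup G (⟨ G ⟩ (Conjugates t))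
  normalClosure-isNormal t = record
    { isSubgroup  = isSub
    ; conj-closed = λ w → ⟨⟩-least (conjPreimage-isSubgroup w isSub)
        λ (y , z≈) → gen (y ∙ w , trans (conj-cong refl z≈) (sym (conj-compat y w t)))
    }
    where isSub = ⟨⟩-isSubgroup G (Conjugates t)

  -- IsSimple speaks about one universe level only; passing through the normal
  -- closure of a single element reaches all the others.
  simple⇒normal-full : IsSimple G → {H : Pred Carrier p} → IsNormalSubgroup G H →
                       Nontrivial G H → ∀ x → x ∈ H
  simple⇒normal-full simple isNormal (t , t∈H , t≉ε) x =
    ⟨⟩-least isSubgroup
      (λ (y , z≈) → IsSubgroup.resp isSubgroup (sym z≈) (conj-closed y t∈H))
      (IsSimple.normal simple (normalClosure-isNormal t)
        (t , gen (ε , sym (conj-identity t)) , t≉ε) x)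
    where open IsNormalSubgroup isNormal

  Central : Pred Carrier (c ⊔ ℓ)
  Central x = ∀ y → x ∙ y ≈ y ∙ x

  Central-isNormal : IsNormalSubgroup G Central
  Central-isNormal = record
    { isSubgroup = record
      -- The centre is the intersection of all centralisers; `Centraliser y` states the equation
      -- with the sides exchanged, hence each `sym`.
      { resp      = λ x≈z x∈Z y → sym (resp y x≈z (sym (x∈Z y)))
      ; ε-closed  = λ y → sym (ε-closed y)
      ; ∙-closed  = λ x∈Z z∈Z y → sym (∙-closed y (sym (x∈Z y)) (sym (z∈Z y)))
      ; ⁻¹-closed = λ x∈Z y → sym (⁻¹-closed y (sym (x∈Z y)))
      }
    ; conj-closed = λ {x} w x∈Z y → sym (resp y (sym (fixed w x∈Z)) (sym (x∈Z y)))
    }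
    where
    open module C y = IsSubgroup (Centraliser-isSubgroup y)

    fixed : ∀ {x} w → x ∈ Central → conj w x ≈ x
    fixed {x} w x∈Z = trans (assoc (w ⁻¹) x w)
      (trans (∙-congˡ (x∈Z w)) (\\-leftDividesʳ w x))

  -- A nontrivial central element makes the normal subgroup `Central` everything. The double
  -- negation stands because equality is not assumed decidable here.
  nonabelianSimple⇒centreless : ¬ IsAbelian G → IsSimple G →
                                ∀ {x} → x ∈ Central → ¬ ¬ (x ≈ ε)
  nonabelianSimple⇒centreless ¬ab simple {x} x∈Z x≉ε =
    ¬ab (simple⇒normal-full simple Central-isNormal (x , x∈Z , x≉ε))

  -- The rotation subgroup ⟨ab⟩ of a dihedral group is abelian and normal.
  involutions⇒¬nonabelianSimple : ¬ IsAbelian G → IsSimple G → ∀ {a b} →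
    Generates G (doubleton G a b) → ¬ (a ≈ b) → a ≈ a ⁻¹ → b ≈ b ⁻¹ → ⊥
  involutions⇒¬nonabelianSimple ¬ab simple {a} {b} gens a≉b a≈a⁻¹ b≈b⁻¹ =
    ¬ab (commutingGenerators⇒abelian rotations-full
      λ x≈d y≈d → trans (∙-cong x≈d y≈d) (sym (∙-cong y≈d x≈d)))
    where
    d = a ∙ b
    D = ⟨ G ⟩ (_≈ d)
    isSub = ⟨⟩-isSubgroup G (_≈ d)

    d⁻¹≈ba : d ⁻¹ ≈ b ∙ a
    d⁻¹≈ba = trans (⁻¹-anti-homo-∙ a b) (∙-cong (sym b≈b⁻¹) (sym a≈a⁻¹))

    conj-a : conj a d ≈ d ⁻¹
    conj-a = trans (∙-congʳ (\\-leftDividesʳ a b)) (sym d⁻¹≈ba)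

    conj-b : conj b d ≈ d ⁻¹
    conj-b = begin
      b ⁻¹ ∙ (a ∙ b) ∙ b      ≈⟨ assoc _ _ b ⟩
      b ⁻¹ ∙ (a ∙ b ∙ b)      ≈⟨ ∙-cong (sym b≈b⁻¹) (∙-congˡ b≈b⁻¹) ⟩
      b ∙ (a ∙ b ∙ b ⁻¹)      ≈⟨ ∙-congˡ (//-rightDividesʳ b a) ⟩
      b ∙ a                   ≈⟨ d⁻¹≈ba ⟨
      d ⁻¹                    ∎

    normalises : ∀ {y} → conj y d ≈ d ⁻¹ → Normalises D y
    normalises {y} eq = ⟨⟩-least (conjPreimage-isSubgroup y isSub)
      λ x≈d → cast (sym (trans (conj-cong refl x≈d) eq)) (inv (gen refl))

    generator : ∀ {s y} → s ≈ s ⁻¹ → conj s d ≈ d ⁻¹ → y ≈ s → y ∈ Normaliser D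
    generator s≈s⁻¹ eq y≈s =
        normalises (trans (conj-cong y≈s refl) eq)
      , normalises (trans (conj-cong (trans (⁻¹-cong y≈s) (sym s≈s⁻¹)) refl) eq)

    rotations-full : Generates G (_≈ d)
    rotations-full = simple⇒normal-full simple
      (record { isSubgroup = isSub ; conj-closed = λ y → proj₁
        (⟨⟩-least (Normaliser-isSubgroup isSub)
          [ generator a≈a⁻¹ conj-a , generator b≈b⁻¹ conj-b ]′ (gens y)) })
      -- If the rotation were trivial, `a` would be the inverse of `b`, which is `b` itself.
      (d , gen refl , λ d≈ε → a≉b (trans (inverseˡ-unique a b d≈ε) (sym b≈b⁻¹)))

-- Cayley graphs

module _ (N : Group c ℓ) where
  open Group N
  open GroupProperties N

  symmetrise-isConnectionSet : {P : Pred Carrier p} →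
    (∀ {x y} → x ≈ y → x ∈ P → y ∈ P) → ¬ (ε ∈ P) →
    IsConnectionSet N (P ∪ _⁻¹ˢ N P)
  symmetrise-isConnectionSet resp ε∉P = record
    { resp      = λ x≈y → Sum.map (resp x≈y) (resp (⁻¹-cong x≈y))
    ; ε∉S       = [ ε∉P , ε∉P ∘ resp ε⁻¹≈ε ]′
    ; ⁻¹-closed = [ inj₂ ∘ resp (sym (⁻¹-involutive _)) , inj₁ ]′
    }

  module _ (fin : Finite setoid) {P : Pred Carrier p} (conn : IsConnectionSet N P) where
    private module Γ = Graph (Cay N fin conn)
    open IsConnectionSet conn

    -- The neighbours of `x` are the elements `s i ⁻¹ ∙ x`, and the quotient of `x` by such a
    -- neighbour recovers `s i`.
    Cay-valency : ∀ {k} (s : Fin k → Carrier) → (∀ {i j} → s i ≈ s j → i ≡ j) →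
                  (∀ i → s i ∈ P) → (∀ {z} → z ∈ P → ∃[ i ] z ≈ s i) → Γ.HasValency k
    Cay-valency s s-injective s∈P index x = record
      { to        = λ (y , xy∈P) → proj₁ (index xy∈P)
      ; from      = λ i → s i ⁻¹ ∙ x , resp (sym (quotient i)) (s∈P i)
      ; to-cong   = λ {(y , yp)} {(z , zp)} y≈z → s-injective
          (trans (sym (proj₂ (index yp))) (trans (∙-congˡ (⁻¹-cong y≈z)) (proj₂ (index zp))))
      ; from-cong = λ { ≡.refl → refl }
      ; inverse   =
          (λ {i} {(y , yp)} y≈ → s-injective
            (trans (sym (proj₂ (index yp))) (trans (∙-congˡ (⁻¹-cong y≈)) (quotient i))))
        , (λ { {y , yp} ≡.refl → trans (∙-congʳ (⁻¹-cong (sym (proj₂ (index yp)))))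
              (trans (∙-congʳ (⁻¹-anti-homo-// x y)) (//-rightDividesˡ x y)) })
      }
      where
      quotient : ∀ i → x ∙ (s i ⁻¹ ∙ x) ⁻¹ ≈ s i
      quotient i = trans (∙-congˡ (trans (⁻¹-anti-homo-∙ _ _) (∙-congˡ (⁻¹-involutive _))))
        (\\-leftDividesˡ x (s i))

  module _ (fin : Finite setoid) {P : Pred Carrier p}
           (conn : IsConnectionSet N (P ∪ _⁻¹ˢ N P)) where
    private module Γ = Graph (Cay N fin conn)
    open IsConnectionSet conn

    Step : Rel Carrier (ℓ ⊔ p)
    Step x y = x ≈ y ⊎ Γ.Adj x y

    -- The elements `z` that admit such a walk for every `x` form a subgroup: walks concatenate for
    -- products and are reversed for inverses. Keeping `x` universally quantified is what lets the
    -- base point shift.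
    translation-walk : ∀ {z} → z ∈ ⟨ N ⟩ P → ∀ x → Star Step (z ∙ x) x
    translation-walk = ⟨⟩-least N
      (record
        { resp      = λ y≈z w x → step (inj₁ (∙-congʳ (sym y≈z))) ◅◅ w x
        ; ε-closed  = λ x → step (inj₁ (identityˡ x))
        ; ∙-closed  = λ {y} {z} w w′ x →
            step (inj₁ (assoc y z x)) ◅◅ w (z ∙ x) ◅◅ w′ x
        ; ⁻¹-closed = λ {y} w x →
            reverse Step-sym (w (y ⁻¹ ∙ x)) ◅◅ step (inj₁ (\\-leftDividesˡ y x))
        })
      (λ {z} z∈P x → step (inj₂ (resp (sym (//-rightDividesʳ x z)) (inj₁ z∈P))))
      where
      Step-sym : ∀ {x y} → Step x y → Step y x
      Step-sym = Sum.map sym Γ.Adj-sym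

    -- The quotients along a walk telescope, and each single step contributes a generator, the
    -- inverse of one, or the identity.
    walk⇒quotient : ∀ {x y} → Star Step x y → x ∙ y ⁻¹ ∈ ⟨ N ⟩ P
    walk⇒quotient = fold (λ x y → x ∙ y ⁻¹ ∈ ⟨ N ⟩ P)
      (λ {x} {y} {z} xy yz → cast (telescope x y z) (mul (step⇒quotient xy) yz))
      (λ {x} → cast (sym (inverseʳ x)) unit)
      where
      telescope : ∀ x y z → x ∙ y ⁻¹ ∙ (y ∙ z ⁻¹) ≈ x ∙ z ⁻¹
      telescope x y z = trans (assoc _ _ _) (∙-congˡ (\\-leftDividesʳ y (z ⁻¹)))

      step⇒quotient : ∀ {x y} → Step x y → x ∙ y ⁻¹ ∈ ⟨ N ⟩ P
      step⇒quotient (inj₁ x≈y)        = cast (sym (x≈y⇒x∙y⁻¹≈ε x≈y)) unit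
      step⇒quotient (inj₂ (inj₁ q∈P)) = gen q∈P
      step⇒quotient (inj₂ (inj₂ q∈P)) = cast (⁻¹-involutive _) (inv (gen q∈P))

    generates⇒connected : Generates N P → Γ.Connected
    generates⇒connected gens x y =
      step (inj₁ (sym (//-rightDividesˡ y x))) ◅◅ translation-walk (gens (x ∙ y ⁻¹)) y

    -- Membership of `z` amounts to a walk from `z` to `ε` in a finite graph, so the decision
    -- procedure for walks applies.
    ⟨⟩? : (∀ x → Dec (x ∈ P)) → ∀ z → Dec (z ∈ ⟨ N ⟩ P)
    ⟨⟩? P? z = map′
      (λ w → cast (trans (∙-congˡ ε⁻¹≈ε) (identityʳ z)) (walk⇒quotient w))
      (λ z∈ → step (inj₁ (sym (identityʳ z))) ◅◅ translation-walk z∈ ε)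
      (star? setoid fin
        ( (λ y≈z → Sum.map (λ x≈y → trans x≈y y≈z) (proj₁ Γ.Adj-resp y≈z))
        , (λ y≈z → Sum.map (trans (sym y≈z)) (proj₂ Γ.Adj-resp y≈z)))
        (inj₁ refl)
        (λ x y → finite⇒dec-≈ setoid fin x y ⊎-dec
                 (P? (x ∙ y ⁻¹) ⊎-dec P? ((x ∙ y ⁻¹) ⁻¹)))
        z ε)

-- Orientation implies edge-transitivity

module _ (Γ : Graph v ℓ e) (G : Group g ℓg) where
  open Graph Γ
  private
    module G = Group G
    module V = Setoid vertices

  -- Each edge, in one of its two directions, is an image of the base pair; if `h` and `k` reach two
  -- edges, then `h G.⁻¹ G.∙ k` carries one to the other.
  oriented⇒edgeTransitive : ∀ {_·_ : Vertex → G.Carrier → Vertex} →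
    IsAutomorphismGroup Γ G _·_ → IsOriented Γ G _·_ → IsEdgeTransitive Γ G _·_
  oriented⇒edgeTransitive {_·_} isAut (x₀ , y₀ , _ , adj⇔) {x} {y} {x′} {y′} xy xy′ =
    combine (Equivalence.to (adj⇔ x y) xy) (Equivalence.to (adj⇔ x′ y′) xy′)
    where
    open IsAutomorphismGroup isAut

    carry : ∀ {z u w} h k → (z · h) ≈ᵥ u → (z · k) ≈ᵥ w → (u · (h G.⁻¹ G.∙ k)) ≈ᵥ w
    carry {z} {u} {w} h k zh zk =
      V.trans (·-cong (V.sym zh) G.refl) (V.trans (V.sym (·-compat z h _))
        (V.trans (·-cong V.refl (GroupProperties.\\-leftDividesˡ G h k)) zk))

    combine : PairOrbit Γ G _·_ x₀ y₀ x y ⊎ PairOrbit Γ G _·_ x₀ y₀ y x →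
              PairOrbit Γ G _·_ x₀ y₀ x′ y′ ⊎ PairOrbit Γ G _·_ x₀ y₀ y′ x′ →
              ∃ λ h → ((x · h) ≈ᵥ x′ × (y · h) ≈ᵥ y′) ⊎ ((x · h) ≈ᵥ y′ × (y · h) ≈ᵥ x′)
    combine (inj₁ (h , p , q)) (inj₁ (k , p′ , q′)) = _ , inj₁ (carry h k p p′ , carry h k q q′)
    combine (inj₁ (h , p , q)) (inj₂ (k , p′ , q′)) = _ , inj₂ (carry h k p p′ , carry h k q q′)
    combine (inj₂ (h , p , q)) (inj₁ (k , p′ , q′)) = _ , inj₂ (carry h k q q′ , carry h k p p′)
    combine (inj₂ (h , p , q)) (inj₂ (k , p′ , q′)) = _ , inj₁ (carry h k q q′ , carry h k p p′)

-- Holomorphs acting on Cayley graphs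

module _ (N : Group c ℓ) {A : Pred (Automorphism N) q} (isSub : IsSubgroup (Aut N) A) where
  open Group N
  open GroupProperties N
  open Automorphism
  private
    G = semidirect N isSub
    _·_ = semidirectAction N isSub
    module A = Group (subgroup (Aut N) isSub)
    module G = Group G

  translation : Carrier → G.Carrier
  translation n = n , A.ε

  translation-transitive : ∀ x y → (x · translation (x ⁻¹ ∙ y)) ≈ y
  translation-transitive = \\-leftDividesˡ

  -- The translation part cancels, so adjacency and orientation depend only on how the automorphism
  -- part acts on quotients.
  quotient-· : ∀ x y h → (x · h) ∙ (y · h) ⁻¹ ≈ ⟦ proj₁ (proj₂ h) ⟧ (x ∙ y ⁻¹)
  quotient-· x y (n , α , _) = begin
    (⟦ α ⟧ x ∙ n) ∙ (⟦ α ⟧ y ∙ n) ⁻¹       ≈⟨ ∙-congˡ (⁻¹-anti-homo-∙ _ n) ⟩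
    (⟦ α ⟧ x ∙ n) ∙ (n ⁻¹ ∙ ⟦ α ⟧ y ⁻¹)    ≈⟨ assoc _ n _ ⟩
    ⟦ α ⟧ x ∙ (n ∙ (n ⁻¹ ∙ ⟦ α ⟧ y ⁻¹))    ≈⟨ ∙-congˡ (\\-leftDividesˡ n _) ⟩
    ⟦ α ⟧ x ∙ ⟦ α ⟧ y ⁻¹                   ≈⟨ ∙-congˡ (⁻¹-homo α y) ⟨
    ⟦ α ⟧ x ∙ ⟦ α ⟧ (y ⁻¹)                 ≈⟨ ∙-homo α x (y ⁻¹) ⟨
    ⟦ α ⟧ (x ∙ y ⁻¹)                       ∎
    where open SetoidReasoning setoid

  holomorph-isAutomorphismGroup : (fin : Finite setoid) {P : Pred Carrier p}
    (conn : IsConnectionSet N P) →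
    (∀ {α z} → α ∈ A → z ∈ P → ⟦ α ⟧ z ∈ P) →
    IsAutomorphismGroup (Cay N fin conn) G _·_
  holomorph-isAutomorphismGroup fin conn invariant = record
    { ·-cong     = λ {x} {y} {(_ , α , _)} x≈y (n≈m , α≈β) →
        ∙-cong (trans (⟦⟧-cong α x≈y) (α≈β y)) n≈m
    ; ·-identity = identityʳ
    ; ·-compat   = λ x (n , α , _) (m , β , _) →
        trans (sym (assoc _ _ m)) (∙-congʳ (sym (∙-homo β (⟦ α ⟧ x) n)))
    -- Evaluating at `ε`, which `α` fixes, isolates the translation part.
    ; faithful   = λ (n , α , _) fixes →
        let n≈ε = trans (sym (trans (∙-congʳ (ε-homo α)) (identityˡ n))) (fixes ε)
        in n≈ε , λ x → trans (sym (trans (∙-congˡ n≈ε) (identityʳ _))) (fixes x)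
    ; preserves  = λ h@(_ , α∈) x y → mk⇔
        (λ xy → resp (sym (quotient-· x y h)) (invariant (proj₂ α∈) xy))
        -- The converse is invariance under the inverse automorphism.
        (λ xy → resp (A.inverseʳ α∈ (x ∙ y ⁻¹))
          (invariant (proj₂ (α∈ A.⁻¹)) (resp (quotient-· x y h) xy)))
    }
    where open IsConnectionSet conn

  module _ (s x y : Carrier) where

    -- Starting the base pair at `ε` makes its quotient `s` itself, so the orbit is determined by
    -- the images of `s` under `A`; conversely the translation part can be taken to be `x`.
    pairOrbit⇒quotient : (∃[ h ] (ε · h) ≈ x × (s · h) ≈ y) →
                         ∃[ α ] α ∈ A × y ∙ x ⁻¹ ≈ ⟦ α ⟧ s
    pairOrbit⇒quotient (h@(_ , α , α∈A) , εh≈x , sh≈y) = α , α∈A ,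
      trans (∙-cong (sym sh≈y) (⁻¹-cong (sym εh≈x)))
        (trans (quotient-· s ε h)
               (⟦⟧-cong α (trans (∙-congˡ ε⁻¹≈ε) (identityʳ s))))

    quotient⇒pairOrbit : ∀ {α} → α ∈ A → y ∙ x ⁻¹ ≈ ⟦ α ⟧ s →
                         ∃[ h ] (ε · h) ≈ x × (s · h) ≈ y
    quotient⇒pairOrbit {α} α∈A eq = (x , α , α∈A)
      , trans (∙-congʳ (ε-homo α)) (identityˡ x)
      , trans (∙-congʳ (sym eq)) (//-rightDividesˡ x y)

  -- Translations are thus normal in `G`; taking `h` a translation or a pure automorphism yields the
  -- closure properties of `Translations`.
  conj-translation : ∀ (h : G.Carrier) m → let (n , α , _) = h in
    conj G h (translation m) G.≈ translation (conj N n (⟦ α ⟧ m))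
  conj-translation (n , α′@(α , _)) m =
      ∙-congʳ (trans (∙-homo α _ m) (∙-congʳ (A.inverseˡ α′ (n ⁻¹))))
    , A.inverseˡ α′

  module _ {H : Pred G.Carrier p} (isNormal : IsNormalSubgroup G H) where
    open IsNormalSubgroup isNormal
    open IsSubgroup isSubgroup

    Translations : Pred Carrier _
    Translations n = translation n ∈ H

    Translations-isNormal : IsNormalSubgroup N Translations
    Translations-isNormal = record
      { isSubgroup = record
        { resp      = λ x≈y → resp (x≈y , λ _ → refl)
        ; ε-closed  = ε-closed
        ; ∙-closed  = λ hx hy → resp (refl , λ _ → refl) (∙-closed hx hy)
        ; ⁻¹-closed = λ hx → resp (refl , λ _ → refl) (⁻¹-closed hx)
        }
      ; conj-closed = λ y hx →
          resp (conj-translation (translation y) _) (conj-closed (translation y) hx)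
      }

    Translations-invariant : ∀ {α m} → α ∈ A → m ∈ Translations → ⟦ α ⟧ m ∈ Translations
    Translations-invariant {α} {m} α∈A hm =
      resp (G.trans {conj G h (translation m)} {translation (conj N ε (⟦ α ⟧ m))}
                    {translation (⟦ α ⟧ m)}
                    (conj-translation h m) (conj-identity N _ , λ _ → refl))
           (conj-closed h hm)
      where
      h : G.Carrier
      h = ε , α , α∈A

    -- The commutator of `h` and `μ` lies in `H` by normality; regrouped as a conjugate of `μ G.⁻¹`
    -- times `μ`, it is a product of translations, even when `h` is not one.
    commutator∈Translations : ∀ {h : G.Carrier} → h ∈ H → ∀ m → let (n , α , _) = h in
      conj N n (⟦ α ⟧ (m ⁻¹)) ∙ m ∈ Translations
    commutator∈Translations {h@(n , α , _)} h∈H m =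
      resp {h G.⁻¹ G.∙ (μ G.⁻¹ G.∙ h G.∙ μ)} {translation (conj N n (⟦ α ⟧ (m ⁻¹)) ∙ m)} eq
        (∙-closed (⁻¹-closed h∈H) (conj-closed μ h∈H))
      where
      μ = translation m
      m^h = conj N n (⟦ α ⟧ (m ⁻¹))
      open SetoidReasoning G.setoid

      eq : h G.⁻¹ G.∙ (μ G.⁻¹ G.∙ h G.∙ μ) G.≈ translation (m^h ∙ m)
      eq = begin
        h G.⁻¹ G.∙ (μ G.⁻¹ G.∙ h G.∙ μ)
          ≈⟨ G.assoc (h G.⁻¹) (μ G.⁻¹ G.∙ h) μ ⟨
        h G.⁻¹ G.∙ (μ G.⁻¹ G.∙ h) G.∙ μ
          ≈⟨ G.∙-cong {conj G h (μ G.⁻¹)} {h G.⁻¹ G.∙ (μ G.⁻¹ G.∙ h)} {μ} {μ}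
               (G.assoc (h G.⁻¹) (μ G.⁻¹) h) (G.refl {μ}) ⟨
        conj G h (μ G.⁻¹) G.∙ μ
          ≈⟨ G.∙-cong {conj G h (μ G.⁻¹)} {translation m^h} {μ} {μ}
               (conj-translation h (m ⁻¹)) (G.refl {μ}) ⟩
        translation m^h G.∙ μ
          ≈⟨ refl , (λ _ → refl) ⟩
        translation (m^h ∙ m)
          ∎

-- The construction

module _ (T : Group c ℓ) where
  open Group T
  open GroupProperties T
  open Construction T
  open Automorphism
  private
    module N = Group N
    module NP = GroupProperties N

  -- Describes the two elements of `⟨τ⟩` by their values, so that membership in the inductively
  -- generated group can be split into two cases.
  IdentityOrSwap : Pred (Automorphism N) (c ⊔ ℓ)
  IdentityOrSwap α = (∀ z → ⟦ α ⟧ z N.≈ z) ⊎ (∀ z → ⟦ α ⟧ z N.≈ swap z)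

  IdentityOrSwap-isSubgroup : IsSubgroup (Aut N) IdentityOrSwap
  IdentityOrSwap-isSubgroup = record
    { resp      = λ {α} {β} α≈β → Sum.map
        (λ f z → N.trans (N.sym (α≈β z)) (f z))
        (λ f z → N.trans (N.sym (α≈β z)) (f z))
    ; ε-closed  = inj₁ λ _ → N.refl
    ; ∙-closed  = λ {α} {β} → λ where
        (inj₁ f) (inj₁ h) → inj₁ λ z → N.trans (h (⟦ α ⟧ z)) (f z)
        (inj₁ f) (inj₂ h) → inj₂ λ z → N.trans (h (⟦ α ⟧ z)) (swap (f z))
        (inj₂ f) (inj₁ h) → inj₂ λ z → N.trans (h (⟦ α ⟧ z)) (f z)
        (inj₂ f) (inj₂ h) → inj₁ λ z → N.trans (h (⟦ α ⟧ z)) (swap (f z))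
    ; ⁻¹-closed = λ {α} → Sum.map
        (λ f z → N.trans (N.sym (f (⟦ α Aut.⁻¹ ⟧ z))) (Aut.inverseˡ α z))
        (λ f z → swap (N.trans (N.sym (f (⟦ α Aut.⁻¹ ⟧ z))) (Aut.inverseˡ α z)))
    }
    where module Aut = Group (Aut N)

  ⟨τ⟩⊆IdentityOrSwap : ∀ {α} → α ∈ ⟨τ⟩ → α ∈ IdentityOrSwap
  ⟨τ⟩⊆IdentityOrSwap {α} =
    ⟨⟩-least (Aut N) IdentityOrSwap-isSubgroup (λ τ≈β → inj₂ λ z → N.sym (τ≈β z)) {α}

  id∈⟨τ⟩ : Group.ε (Aut N) ∈ ⟨τ⟩
  id∈⟨τ⟩ = unit

  τ∈⟨τ⟩ : τ ∈ ⟨τ⟩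
  τ∈⟨τ⟩ = gen λ _ → N.refl

  -- The subgroup generated by `S₀` and Goursat's argument

  module _ (a b : Carrier) where

    S₀-resp : ∀ {x y} → x N.≈ y → x ∈ S₀ a b → y ∈ S₀ a b
    S₀-resp x≈y = Sum.map (N.trans (N.sym x≈y)) (N.trans (N.sym x≈y))

    S₀-swap : ∀ {z} → z ∈ S₀ a b → swap z ∈ S₀ a b
    S₀-swap = [ inj₂ ∘ swap , inj₁ ∘ swap ]′

    S₀-invariant : ∀ {α z} → α ∈ ⟨τ⟩ → z ∈ S₀ a b → ⟦ α ⟧ z ∈ S₀ a b
    S₀-invariant {z = z} α∈ z∈ with ⟨τ⟩⊆IdentityOrSwap α∈
    ... | inj₁ α≈id = S₀-resp (N.sym (α≈id z)) z∈
    ... | inj₂ α≈τ  = S₀-resp (N.sym (α≈τ z)) (S₀-swap z∈)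

    S-invariant : ∀ {α z} → α ∈ ⟨τ⟩ → z ∈ S a b → ⟦ α ⟧ z ∈ S a b
    S-invariant {α} α∈ = Sum.map (S₀-invariant α∈)
      (λ z⁻¹∈ → S₀-resp (⁻¹-homo α _) (S₀-invariant α∈ z⁻¹∈))

    M : Pred N.Carrier (c ⊔ ℓ)
    M = ⟨ N ⟩ (S₀ a b)

    M-swap : ∀ {z} → z ∈ M → swap z ∈ M
    M-swap = ⟨⟩-least N {H = λ z → swap z ∈ M}
      (record { resp = cast ∘ swap ; ε-closed = unit ; ∙-closed = mul ; ⁻¹-closed = inv })
      (gen ∘ S₀-swap)

    M-projection : Generates T (doubleton T a b) → ∀ t → ∃[ u ] (t , u) ∈ M
    M-projection gens t = ⟨⟩-least T {H = λ t → ∃[ u ] (t , u) ∈ M}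
      (record
        { resp      = λ x≈y (u , xu) → u , cast (x≈y , refl) xu
        ; ε-closed  = ε , unit
        ; ∙-closed  = λ (u , xu) (w , yw) → u ∙ w , mul xu yw
        ; ⁻¹-closed = λ (u , xu) → u ⁻¹ , inv xu
        })
      [ (λ x≈a → b , gen (inj₁ (x≈a , refl))) , (λ x≈b → a , gen (inj₂ (x≈b , refl))) ]′
      (gens t)

    -- A trivial kernel makes second components determine first ones, and invariance under `swap`
    -- gives the reverse, so `M` is the graph of a bijection `φ`. Closure of `M` makes `φ` a
    -- homomorphism, and its two generators say that `φ` interchanges `a` and `b`.
    M-kernel-trivial⇒interchange : Generates T (doubleton T a b) →
      (∀ x → (x , ε) ∈ M → x ≈ ε) → ∃[ φ ] ⟦_⟧ {G = T} φ a ≈ b × ⟦ φ ⟧ b ≈ a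
    M-kernel-trivial⇒interchange gens trivial =
      record
        { ⟦_⟧ = φ
        ; isGroupIsomorphism = record
          { isGroupMonomorphism = record
            { isGroupHomomorphism = record
              { isMonoidHomomorphism = record
                { isMagmaHomomorphism = record
                  { isRelHomomorphism = record
                    { cong = λ x≈y → determined (graph _) (graph _) x≈y }
                  ; homo = λ x y → determined (graph _) (mul (graph x) (graph y)) refl
                  }
                ; ε-homo = determined (graph ε) unit refl
                }
              ; ⁻¹-homo = λ x → determined (graph (x ⁻¹)) (inv (graph x)) refl
              }
            ; injective = λ φx≈φy → codetermined (graph _) (graph _) φx≈φy
            }
          -- Since `M` is invariant under `swap`, `φ` is its own inverse.
          ; surjective = λ y → φ y , λ {z} z≈φy →
              determined (graph z) (M-swap (graph y)) z≈φy
          }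
        }
      , determined (graph a) (gen (inj₁ N.refl)) refl
      , determined (graph b) (gen (inj₂ N.refl)) refl
      where
      φ : Carrier → Carrier
      φ t = proj₁ (M-projection gens t)

      graph : ∀ t → (t , φ t) ∈ M
      graph t = proj₂ (M-projection gens t)

      codetermined : ∀ {x y u w} → (x , u) ∈ M → (y , w) ∈ M → u ≈ w → x ≈ y
      codetermined xu yw u≈w =
        x∙y⁻¹≈ε⇒x≈y _ _ (trivial _ (cast (refl , x≈y⇒x∙y⁻¹≈ε u≈w) (mul xu (inv yw))))

      determined : ∀ {x y u w} → (x , u) ∈ M → (y , w) ∈ M → x ≈ y → u ≈ w
      determined xu yw = codetermined (M-swap xu) (M-swap yw)

  leftFactor⇒full : ∀ {H : Pred N.Carrier p} → IsSubgroup N H →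
    (∀ {z} → z ∈ H → swap z ∈ H) → (∀ x → (x , ε) ∈ H) → ∀ z → z ∈ H
  leftFactor⇒full isSub H-swap left (x , y) =
    resp (identityʳ x , identityˡ y) (∙-closed (left x) (H-swap (left y)))
    where open IsSubgroup isSub

  module _ {H : Pred N.Carrier p} (isNormal : IsNormalSubgroup N H) where
    open IsNormalSubgroup isNormal
    open IsSubgroup isSubgroup

    leftFactor-isNormal : IsNormalSubgroup T (λ x → (x , ε) ∈ H)
    leftFactor-isNormal = record
      { isSubgroup = record
        { resp      = λ x≈y → resp (x≈y , refl)
        ; ε-closed  = ε-closed
        ; ∙-closed  = λ hx hy → resp (refl , identityʳ ε) (∙-closed hx hy)
        ; ⁻¹-closed = λ hx → resp (refl , ε⁻¹≈ε) (⁻¹-closed hx)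
        }
      ; conj-closed = λ y hx → resp (refl , conj-identity T ε) (conj-closed (y , ε) hx)
      }

  -- Connection set and connectedness

  module Properties
    (fin : Finite setoid) (¬abelian : ¬ IsAbelian T) (simple : IsSimple T)
    (a b : Carrier) (gens : Generates T (doubleton T a b))
    (noSwap : ¬ (∃[ φ ] ⟦_⟧ {G = T} φ a ≈ b × ⟦ φ ⟧ b ≈ a))
    where

    _≈?_ : Decidable _≈_
    _≈?_ = finite⇒dec-≈ setoid fin

    -- Otherwise the identity would interchange them.
    a≉b : ¬ (a ≈ b)
    a≉b a≈b = noSwap (Group.ε (Aut T) , a≈b , sym a≈b)

    a⁻¹≉b : ¬ (a ⁻¹ ≈ b)
    a⁻¹≉b a⁻¹≈b = ¬abelian (commutingGenerators⇒abelian T gens λ where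
      (inj₁ x≈a) (inj₁ y≈a) → same x≈a y≈a
      (inj₁ x≈a) (inj₂ y≈b) → trans (∙-cong x≈a y≈b) (trans ab≈ba (sym (∙-cong y≈b x≈a)))
      (inj₂ x≈b) (inj₁ y≈a) → trans (∙-cong x≈b y≈a) (trans (sym ab≈ba) (sym (∙-cong y≈a x≈b)))
      (inj₂ x≈b) (inj₂ y≈b) → same x≈b y≈b)
      where
      ab≈ba : a ∙ b ≈ b ∙ a
      ab≈ba = trans (∙-congˡ (sym a⁻¹≈b))
        (trans (inverseʳ a) (trans (sym (inverseˡ a)) (∙-congʳ a⁻¹≈b)))
      same : ∀ {x y s} → x ≈ s → y ≈ s → x ∙ y ≈ y ∙ x
      same x≈s y≈s = trans (∙-cong x≈s y≈s) (sym (∙-cong y≈s x≈s))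

    notBothInvolutions : a ⁻¹ ≈ a → b ⁻¹ ≈ b → ⊥
    notBothInvolutions a⁻¹≈a b⁻¹≈b =
      involutions⇒¬nonabelianSimple T ¬abelian simple gens a≉b (sym a⁻¹≈a) (sym b⁻¹≈b)

    -- If an element of `S₀` is its own inverse, both `a` and `b` are involutions and `T` would be
    -- dihedral; if it is inverse to the other element, `b` is `a ⁻¹` and `T` would be abelian.
    -- Looplessness, valency 4 and the orientation all rest on this.
    S₀-antisymmetric : ∀ {z} → z ∈ S₀ a b → ¬ (z N.⁻¹ ∈ S₀ a b)
    S₀-antisymmetric (inj₁ z≈ab) (inj₁ z⁻¹≈ab) =
      let (p , q) = N.trans (N.⁻¹-cong (N.sym z≈ab)) z⁻¹≈ab in notBothInvolutions p q
    S₀-antisymmetric (inj₁ z≈ab) (inj₂ z⁻¹≈ba) =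
      a⁻¹≉b (proj₁ (N.trans (N.⁻¹-cong (N.sym z≈ab)) z⁻¹≈ba))
    S₀-antisymmetric (inj₂ z≈ba) (inj₁ z⁻¹≈ab) =
      a⁻¹≉b (proj₂ (N.trans (N.⁻¹-cong (N.sym z≈ba)) z⁻¹≈ab))
    S₀-antisymmetric (inj₂ z≈ba) (inj₂ z⁻¹≈ba) =
      let (q , p) = N.trans (N.⁻¹-cong (N.sym z≈ba)) z⁻¹≈ba in notBothInvolutions p q

    S-isConnectionSet : IsConnectionSet N (S a b)
    S-isConnectionSet = symmetrise-isConnectionSet N (S₀-resp a b)
      λ ε∈S₀ → S₀-antisymmetric ε∈S₀ (S₀-resp a b (N.sym NP.ε⁻¹≈ε) ε∈S₀)

    Γ : Graph c ℓ ℓ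
    Γ = Cay N (finiteN fin) S-isConnectionSet

    S₀? : ∀ z → Dec (z ∈ S₀ a b)
    S₀? (x , y) = (x ≈? a ×-dec y ≈? b) ⊎-dec (x ≈? b ×-dec y ≈? a)

    M? : ∀ z → Dec (z ∈ M a b)
    M? = ⟨⟩? N (finiteN fin) S-isConnectionSet S₀?

    -- The goal is positive but `noSwap` is only a refutation, so the Goursat dichotomy is decided
    -- by searching the finite group for a nontrivial element of the kernel.
    S₀-generates : Generates N (S₀ a b)
    S₀-generates with any-finite? setoid fin {P = λ x → ¬ (x ≈ ε) × (x , ε) ∈ M a b}
        (λ x≈y (x≉ε , x∈) → x≉ε ∘ trans x≈y , cast (x≈y , refl) x∈)
        (λ x → ¬? (x ≈? ε) ×-dec M? (x , ε))
    ... | yes (x , x≉ε , x∈) = leftFactor⇒full (⟨⟩-isSubgroup N (S₀ a b)) (M-swap a b)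
      (simple⇒normal-full T simple kernel-isNormal (x , x∈ , x≉ε))
      where
      -- Conjugation by y ∈ T is induced by an element (y , u) of M.
      kernel-isNormal : IsNormalSubgroup T (λ x → (x , ε) ∈ M a b)
      kernel-isNormal = record
        { isSubgroup = record
          { resp      = λ x≈y → cast (x≈y , refl)
          ; ε-closed  = unit
          ; ∙-closed  = λ hx hy → cast (refl , identityʳ ε) (mul hx hy)
          ; ⁻¹-closed = λ hx → cast (refl , ε⁻¹≈ε) (inv hx)
          }
        ; conj-closed = λ y hx →
            let (u , yu) = M-projection a b gens y
            in cast (refl , conj-ε T u) (mul (mul (inv yu) hx) yu)
        }
    ... | no ¬∃ = ⊥-elim (noSwap (M-kernel-trivial⇒interchange a b gens
      λ x x∈ → decidable-stable (x ≈? ε) λ x≉ε → ¬∃ (x , x≉ε , x∈)))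

    -- Valency 4

    enumerate : Fin 4 → N.Carrier
    enumerate 0F = a , b
    enumerate 1F = b , a
    enumerate 2F = a ⁻¹ , b ⁻¹
    enumerate 3F = b ⁻¹ , a ⁻¹

    -- Coincidences inside `S₀` or inside its inverse force `a ≈ b`; those between the two sets
    -- contradict `S₀-antisymmetric`.
    enumerate-injective : ∀ {i j} → enumerate i N.≈ enumerate j → i ≡ j
    enumerate-injective {0F} {0F} _ = ≡.refl
    enumerate-injective {0F} {1F} e = ⊥-elim (a≉b (proj₁ e))
    enumerate-injective {0F} {2F} e = ⊥-elim (S₀-antisymmetric (inj₁ N.refl) (inj₁ (N.sym e)))
    enumerate-injective {0F} {3F} e = ⊥-elim (S₀-antisymmetric (inj₂ N.refl) (inj₁ (N.sym e)))
    enumerate-injective {1F} {0F} e = ⊥-elim (a≉b (proj₂ e))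
    enumerate-injective {1F} {1F} _ = ≡.refl
    enumerate-injective {1F} {2F} e = ⊥-elim (S₀-antisymmetric (inj₁ N.refl) (inj₂ (N.sym e)))
    enumerate-injective {1F} {3F} e = ⊥-elim (S₀-antisymmetric (inj₂ N.refl) (inj₂ (N.sym e)))
    enumerate-injective {2F} {0F} e = ⊥-elim (S₀-antisymmetric (inj₁ N.refl) (inj₁ e))
    enumerate-injective {2F} {1F} e = ⊥-elim (S₀-antisymmetric (inj₁ N.refl) (inj₂ e))
    enumerate-injective {2F} {2F} _ = ≡.refl
    enumerate-injective {2F} {3F} e = ⊥-elim (a≉b (⁻¹-injective (proj₁ e)))
    enumerate-injective {3F} {0F} e = ⊥-elim (S₀-antisymmetric (inj₂ N.refl) (inj₁ e))
    enumerate-injective {3F} {1F} e = ⊥-elim (S₀-antisymmetric (inj₂ N.refl) (inj₂ e))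
    enumerate-injective {3F} {2F} e = ⊥-elim (a≉b (⁻¹-injective (proj₂ e)))
    enumerate-injective {3F} {3F} _ = ≡.refl

    enumerate∈S : ∀ i → enumerate i ∈ S a b
    enumerate∈S 0F = inj₁ (inj₁ N.refl)
    enumerate∈S 1F = inj₁ (inj₂ N.refl)
    enumerate∈S 2F = inj₂ (inj₁ (NP.⁻¹-involutive _))
    enumerate∈S 3F = inj₂ (inj₂ (NP.⁻¹-involutive _))

    S-index : ∀ {z} → z ∈ S a b → ∃[ i ] z N.≈ enumerate i
    S-index (inj₁ (inj₁ z≈))   = 0F , z≈
    S-index (inj₁ (inj₂ z≈))   = 1F , z≈
    S-index (inj₂ (inj₁ z⁻¹≈)) = 2F , N.sym (NP.⁻¹-selfInverse z⁻¹≈)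
    S-index (inj₂ (inj₂ z⁻¹≈)) = 3F , N.sym (NP.⁻¹-selfInverse z⁻¹≈)

    -- Action and orientation

    isAutomorphismGroup : IsAutomorphismGroup Γ G action
    isAutomorphismGroup = holomorph-isAutomorphismGroup N ⟨τ⟩-isSubgroup
      (finiteN fin) S-isConnectionSet (S-invariant a b)

    Δ : Rel N.Carrier (c ⊔ ℓ)
    Δ = PairOrbit Γ G action N.ε (a , b)

    Δ⇒S₀ : ∀ {x y} → Δ x y → y N.∙ x N.⁻¹ ∈ S₀ a b
    Δ⇒S₀ {x} {y} xy =
      let (α , α∈ , eq) = pairOrbit⇒quotient N ⟨τ⟩-isSubgroup (a , b) x y xy
      in S₀-resp a b (N.sym eq) (S₀-invariant a b α∈ (inj₁ N.refl))

    -- The identity reaches the quotient `(a , b)` and `τ` reaches `(b , a)`; with `Δ⇒S₀`, the orbit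
    -- is exactly the Cayley orientation.
    S₀⇒Δ : ∀ {x y} → y N.∙ x N.⁻¹ ∈ S₀ a b → Δ x y
    S₀⇒Δ {x} {y} (inj₁ eq) = quotient⇒pairOrbit N ⟨τ⟩-isSubgroup (a , b) x y id∈⟨τ⟩ eq
    S₀⇒Δ {x} {y} (inj₂ eq) = quotient⇒pairOrbit N ⟨τ⟩-isSubgroup (a , b) x y τ∈⟨τ⟩ eq

    oriented : IsOriented Γ G action
    oriented = N.ε , (a , b)
      , (λ x y xy yx → S₀-antisymmetric (Δ⇒S₀ yx)
          (S₀-resp a b (N.sym (NP.⁻¹-anti-homo-// x y)) (Δ⇒S₀ xy)))
      , λ x y → mk⇔
          -- Adjacency uses the quotient of `x` by `y`, the orientation that of `y` by `x`, so the
          -- two alternatives cross over.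
          [ inj₂ ∘ S₀⇒Δ , inj₁ ∘ S₀⇒Δ ∘ S₀-resp a b (NP.⁻¹-anti-homo-// x y) ]′
          [ inj₂ ∘ S₀-resp a b (N.sym (NP.⁻¹-anti-homo-// x y)) ∘ Δ⇒S₀ , inj₁ ∘ Δ⇒S₀ ]′

    -- Quasiprimitivity

    noncommuting : ∀ {x} → ¬ (x ≈ ε) → ∃[ t ] ¬ (x ∙ t ≈ t ∙ x)
    noncommuting {x} x≉ε with (x ∙ a) ≈? (a ∙ x) | (x ∙ b) ≈? (b ∙ x)
    ... | no xa≉ax  | _         = a , xa≉ax
    ... | yes _     | no xb≉bx  = b , xb≉bx
    -- Commuting with both generators makes `x` central.
    ... | yes xa≈ax | yes xb≈bx = ⊥-elim (nonabelianSimple⇒centreless T ¬abelian simple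
      (λ y → ⟨⟩-least T isSub
        [ (λ s≈a → resp (sym s≈a) xa≈ax) , (λ s≈b → resp (sym s≈b) xb≈bx) ]′ (gens y)) x≉ε)
      where
      isSub = Centraliser-isSubgroup T x
      open IsSubgroup isSub

    nontrivialElement : ∃[ t ] ¬ (t ≈ ε)
    nontrivialElement with a ≈? ε
    ... | no a≉ε  = a , a≉ε
    ... | yes a≈ε = b , λ b≈ε → a≉b (trans a≈ε (sym b≈ε))

    module _ {H : Pred (Group.Carrier G) p} (isNormal : IsNormalSubgroup G H) where
      private
        K : Pred N.Carrier p
        K = Translations N ⟨τ⟩-isSubgroup isNormal

        K-isNormal : IsNormalSubgroup N K
        K-isNormal = Translations-isNormal N ⟨τ⟩-isSubgroup isNormal

        open IsNormalSubgroup K-isNormal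
        open IsSubgroup isSubgroup

        K-swap : ∀ {z} → z ∈ K → swap z ∈ K
        K-swap = Translations-invariant N ⟨τ⟩-isSubgroup isNormal τ∈⟨τ⟩

        commutator : ∀ {n α} (α∈ : α ∈ ⟨τ⟩) → (n , α , α∈) ∈ H → ∀ m →
                     conj N n (⟦ α ⟧ (m N.⁻¹)) N.∙ m ∈ K
        commutator _ = commutator∈Translations N ⟨τ⟩-isSubgroup isNormal

      -- The commutator with `(t , ε)` has trivial second component, and its first is nontrivial as
      -- soon as `x` and `t` do not commute.
      nontrivialLeft⇒full : ∀ {x y} → ¬ (x ≈ ε) → (x , y) ∈ K → ∀ z → z ∈ K
      nontrivialLeft⇒full {x} {y} x≉ε xy∈K =
        let (t , xt≉tx) = noncommuting x≉ε in
        leftFactor⇒full isSubgroup K-swap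
          (simple⇒normal-full T simple (leftFactor-isNormal K-isNormal)
            ( conj T x (t ⁻¹) ∙ t
            , resp (refl , trans (identityʳ _) (trans (conj-cong T refl ε⁻¹≈ε) (conj-ε T y)))
                   (commutator id∈⟨τ⟩ xy∈K (t , ε))
            , xt≉tx ∘ commute x t))
        where
        commute : ∀ x t → conj T x (t ⁻¹) ∙ t ≈ ε → x ∙ t ≈ t ∙ x
        commute x t eq = begin
          x ∙ t                    ≈⟨ ∙-congˡ (inverseʳ-unique _ t eq) ⟩
          x ∙ conj T x (t ⁻¹) ⁻¹   ≈⟨ ∙-congˡ (conj-⁻¹ T x (t ⁻¹)) ⟨
          x ∙ conj T x (t ⁻¹ ⁻¹)   ≈⟨ ∙-congˡ (conj-cong T refl (⁻¹-involutive t)) ⟩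
          x ∙ (x ⁻¹ ∙ t ∙ x)       ≈⟨ ∙-congˡ (assoc _ t x) ⟩
          x ∙ (x ⁻¹ ∙ (t ∙ x))     ≈⟨ \\-leftDividesˡ x (t ∙ x) ⟩
          t ∙ x                    ∎
          where open SetoidReasoning setoid

      nontrivial⇒full : Nontrivial G H → ∀ z → z ∈ K
      nontrivial⇒full (((x , y) , α , α∈) , h∈H , h≉ε) with ⟨τ⟩⊆IdentityOrSwap α∈
      ... | inj₁ α≈id = fromTranslation (x ≈? ε)
        where
        xy∈K : (x , y) ∈ K
        xy∈K = IsSubgroup.resp (IsNormalSubgroup.isSubgroup isNormal) (N.refl , α≈id) h∈H

        fromTranslation : Dec (x ≈ ε) → ∀ z → z ∈ K
        fromTranslation (no x≉ε)  = nontrivialLeft⇒full x≉ε xy∈K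
        -- Here `y` must be nontrivial, and `swap` moves it to the left.
        fromTranslation (yes x≈ε) =
          nontrivialLeft⇒full (λ y≈ε → h≉ε ((x≈ε , y≈ε) , α≈id)) (K-swap xy∈K)
      -- Outside `N`, the automorphism moves the inverse of `(t , ε)` into the second factor, so the
      -- commutator keeps `t` as its first component.
      ... | inj₂ α≈τ = let (t , t≉ε) = nontrivialElement in
        nontrivialLeft⇒full t≉ε (resp (firstComponent t , refl) (commutator α∈ h∈H (t , ε)))
        where
        firstComponent : ∀ t → proj₁ (conj N (x , y) (⟦ α ⟧ ((t , ε) N.⁻¹)) N.∙ (t , ε)) ≈ t
        firstComponent t = trans (∙-congʳ (trans
          (conj-cong T refl (trans (proj₁ (α≈τ _)) ε⁻¹≈ε)) (conj-ε T x))) (identityˡ t)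

    isBasicQuasiprimitive : ∀ p → IsBasicQuasiprimitive Γ G action p
    isBasicQuasiprimitive p = record
      { inOG4 = record
        { connected           = generates⇒connected N (finiteN fin) S-isConnectionSet S₀-generates
        ; valency4            = Cay-valency N (finiteN fin) S-isConnectionSet
                                  enumerate enumerate-injective enumerate∈S S-index
        ; isAutomorphismGroup = isAutomorphismGroup
        ; vertexTransitive    = λ x y → translation N ⟨τ⟩-isSubgroup (x N.⁻¹ N.∙ y)
                              , translation-transitive N ⟨τ⟩-isSubgroup x y
        ; edgeTransitive      = oriented⇒edgeTransitive Γ G isAutomorphismGroup oriented
        ; oriented            = oriented
        }
      ; quasiprimitive = λ isNormal nontrivial x y →
            translation N ⟨τ⟩-isSubgroup (x N.⁻¹ N.∙ y)
          , nontrivial⇒full isNormal nontrivial (x N.⁻¹ N.∙ y)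
          , translation-transitive N ⟨τ⟩-isSubgroup x y
      }

lemma4p8 : ∀ {c ℓ} p (T : Group c ℓ) → let open Group T in let open Construction T in
    (fin : Finite setoid) → ¬ IsAbelian T → IsSimple T →
    (a b : Carrier) → Generates T (doubleton T a b) →
    ¬ (∃[ φ ] Automorphism.⟦_⟧ {G = T} φ a ≈ b × Automorphism.⟦_⟧ φ b ≈ a) →
    Σ[ conn ∈ IsConnectionSet N (S a b) ]
    IsBasicQuasiprimitive (Cay N (finiteN fin) conn) G action p
lemma4p8 p T fin ¬abelian simple a b gens noSwap =
  S-isConnectionSet , isBasicQuasiprimitive p
  where open Properties T fin ¬abelian simple a b gens noSwap
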